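{- Let $p\ge2$ be an integer, $F=(F[0],\dots,F[p-1])$ a closed $p$-fibred function, and $k\ge1$ an integer. Then: (1) If $F[r]$ is weakly $(p,r)$-suitable at $\{0,\dots,k\}$ for every $r\in\{0,\dots,p-1\}$, then $F$ has the weak block property at $\{0,\dots,k\}$. In particular, if $F[r]$ is weakly $(p,r)$-suitable for every $r\in\{0,\dots,p-1\}$, then $F$ has the weak block property. (2) $F[r]$ is $(p,r)$-suitable at $\{0,\dots,k\}$ for every $r\in\{0,\dots,p-1\}$ if and only if $F$ has the block property at $\{0,\dots,k\}$. In particular, $F[r]$ is $(p,r)$-suitable for every $r\in\{0,\dots,p-1\}$ if and only if $F$ has the block property.
   Context: $p\ge2$ is an integer, not necessarily prime. $\mathbb{Z}_p=\varprojlim \mathbb{Z}/p^k\mathbb{Z}$; every $a\in\mathbb{Z}_p$ is uniquely $a=\sum_{i\ge0}a_ip^i$ with $a_i\in\{0,\dots,p-1\}$, and $a\,\%\,p:=a_0$. A $p$-fibred function with domain $A\subseteq\mathbb{Z}_p$ is a $p$-tuple $F=(F[0],\dots,F[p-1])$ of functions $F[r]:A\to\mathbb{Z}_p$, regarded also as a function $F:A\to\mathbb{Z}_p$ by $F(n)=\dfrac{F[n\%p](n)-(F[n\%p](n)\,\%\,p)}{p}$. It is closed if $F(A)\subseteq A$. For closed $F$, the $F$-digit expansion of $n\in A$ is the sequence $(F^k(n)\,\%\,p)_{k\ge0}$. For $K\subseteq\mathbb{N}_0=\{0,1,2,\dots\}$, a closed $F$ has the weak block property at $K$ if for all $k\in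 K$ and $m,n\in A$: $m\equiv n\pmod{p^k}$ implies that the first $k$ entries of the $F$-digit expansions of $m$ and $n$ coincide; it has the block property at $K$ if this implication is an equivalence for all $k\in K$ and $m,n\in A$. "Weak block property" and "block property" without specification mean $K=\mathbb{N}_0$. For $r\in\{0,\dots,p-1\}$, a function $f:A\to\mathbb{Z}_p$ is weakly $(p,r)$-suitable at $K$ if for all $k\in K$ and all $m,n\in(r+p\mathbb{Z}_p)\cap A$: $m\equiv n\pmod{p^k}$ implies $f(m)-(f(m)\%p)\equiv f(n)-(f(n)\%p)\pmod{p^k}$; it is $(p,r)$-suitable at $K$ if this implication is an equivalence for all such $k,m,n$. Without specification, $K=\mathbb{N}_0$. -}

module Defs where

open import Data.Fin.Base using (Fin; toℕ; fromℕ<)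
open import Data.Fin.Properties using (toℕ-fromℕ<; toℕ<n; toℕ-injective)
open import Data.Integer.Base as ℤ using (ℤ; +_; _%ℕ_; _/ℕ_; ∣_∣)
import Data.Integer.Properties as ℤ
open import Data.Integer.Divisibility.Signed
open import Data.Integer.DivMod using (n%ℕd<d; a≡a%ℕn+[a/ℕn]*n)
open import Data.Integer.Tactic.RingSolver using (solve-∀)
open import Data.Nat.Base as ℕ
  using (ℕ; zero; suc; _^_; _≤_; _<_; NonZero; NonTrivial; nonTrivial⇒nonZero)
import Data.Nat.Properties as ℕ
import Data.Nat.Divisibility as ℕ
open import Data.Nat.GeneralisedArithmetic using (iterate)
open import Data.Product.Base using (Σ; ∃; _,_; proj₁; proj₂)
open import Function.Base using (id)
open import Function.Bundles using (Func; _⇔_; mk⇔)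
open import Level using (Level; 0ℓ)
open import Relation.Binary.Bundles using (Setoid)
import Relation.Binary.Construct.On as On
open import Relation.Binary.PropositionalEquality
  using (_≡_; refl; sym; trans; cong; cong₂; subst)
open import Relation.Nullary.Negation using (contradiction)
open import Relation.Unary using (Pred)

private variable ℓ : Level

upTo : ℕ → Pred ℕ 0ℓ
upTo k j = j ≤ k

module PAdic (p : ℕ) .{{_ : NonTrivial p}} where

  private instance
    p≢0 : NonZero p
    p≢0 = nonTrivial⇒nonZero p

  -- The inverse limit of the rings ℤ/pᵏℤ: the class of an element in ℤ/pᵏℤ is
  -- given by an integer representative `res k`, and two elements are identified
  -- (see _≈_) when all their classes agree.
  record ℤₚ : Set where
    field
      res : ℕ → ℤ
      coh : ∀ k → + (p ^ k) ∣ res (suc k) ℤ.- res k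

  open ℤₚ public

  infix 4 _≡_[modp^_] _≈_

  -- Equality of the images in ℤ/pᵏℤ; see ≡[modp^]⇔∣ for the equivalence with
  -- divisibility of a - b by pᵏ in ℤₚ.
  _≡_[modp^_] : ℤₚ → ℤₚ → ℕ → Set
  a ≡ b [modp^ k ] = + (p ^ k) ∣ res a k ℤ.- res b k

  _≈_ : ℤₚ → ℤₚ → Set
  a ≈ b = ∀ k → a ≡ b [modp^ k ]

  private
    ∣-resp : ∀ {d x y} → x ≡ y → d ∣ x → d ∣ y
    ∣-resp refl = id

    ∣-respˡ : ∀ {d e x} → d ≡ e → d ∣ x → e ∣ x
    ∣-respˡ refl = id

    p^k∣p^[j+k] : ∀ j k → + (p ^ k) ∣ + (p ^ (j ℕ.+ k))
    p^k∣p^[j+k] j k = ∣ᵤ⇒∣ (ℕ.divides (p ^ j) (ℕ.^-distribˡ-+-* p j k))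

  modp^-refl : ∀ {k} a → a ≡ a [modp^ k ]
  modp^-refl {k} a = divides ℤ.0ℤ (ℤ.+-inverseʳ (res a k))

  modp^-sym : ∀ {k} a b → a ≡ b [modp^ k ] → b ≡ a [modp^ k ]
  modp^-sym {k} a b h = ∣-resp (lem (res a k) (res b k)) (∣m⇒∣-m h)
    where
    lem : ∀ x y → ℤ.- (x ℤ.- y) ≡ y ℤ.- x
    lem = solve-∀

  modp^-trans : ∀ {k} a b c → a ≡ b [modp^ k ] → b ≡ c [modp^ k ] →
                a ≡ c [modp^ k ]
  modp^-trans {k} a b c h h′ =
    ∣-resp (lem (res a k) (res b k) (res c k)) (∣m∣n⇒∣m+n h h′)
    where
    lem : ∀ x y z → (x ℤ.- y) ℤ.+ (y ℤ.- z) ≡ x ℤ.- z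
    lem = solve-∀

  setoid : Setoid 0ℓ 0ℓ
  setoid = record
    { Carrier = ℤₚ
    ; _≈_ = _≈_
    ; isEquivalence = record
      { refl  = λ {a} _ → modp^-refl a
      ; sym   = λ {a} {b} h k → modp^-sym a b (h k)
      ; trans = λ {a} {b} {c} h h′ k → modp^-trans a b c (h k) (h′ k)
      }
    }

  infixl 6 _+_ _-_
  infixl 7 _*_

  ι : ℕ → ℤₚ
  ι n = record
    { res = λ _ → + n
    ; coh = λ _ → divides ℤ.0ℤ (ℤ.+-inverseʳ (+ n))
    }

  _+_ : ℤₚ → ℤₚ → ℤₚ
  a + b = record
    { res = λ k → res a k ℤ.+ res b k
    ; coh = λ k →
        ∣-resp (lem (res a (suc k)) (res a k) (res b (suc k)) (res b k))
               (∣m∣n⇒∣m+n (coh a k) (coh b k))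
    }
    where
    lem : ∀ x x′ y y′ → (x ℤ.- x′) ℤ.+ (y ℤ.- y′) ≡ (x ℤ.+ y) ℤ.- (x′ ℤ.+ y′)
    lem = solve-∀

  _-_ : ℤₚ → ℤₚ → ℤₚ
  a - b = record
    { res = λ k → res a k ℤ.- res b k
    ; coh = λ k →
        ∣-resp (lem (res a (suc k)) (res a k) (res b (suc k)) (res b k))
               (∣m∣n⇒∣m-n (coh a k) (coh b k))
    }
    where
    lem : ∀ x x′ y y′ → (x ℤ.- x′) ℤ.- (y ℤ.- y′) ≡ (x ℤ.- y) ℤ.- (x′ ℤ.- y′)
    lem = solve-∀

  _*_ : ℤₚ → ℤₚ → ℤₚ
  a * b = record
    { res = λ k → res a k ℤ.* res b k
    ; coh = λ k →
        ∣-resp (lem (res a (suc k)) (res a k) (res b (suc k)) (res b k))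
               (∣m∣n⇒∣m+n (∣n⇒∣m*n (res b (suc k)) (coh a k))
                          (∣n⇒∣m*n (res a k) (coh b k)))
    }
    where
    lem : ∀ x x′ y y′ →
          y ℤ.* (x ℤ.- x′) ℤ.+ x′ ℤ.* (y ℤ.- y′) ≡ x ℤ.* y ℤ.- x′ ℤ.* y′
    lem = solve-∀

  coh⁺ : ∀ a j k → + (p ^ k) ∣ res a (j ℕ.+ k) ℤ.- res a k
  coh⁺ a zero    k = modp^-refl {k} a
  coh⁺ a (suc j) k =
    ∣-resp (lem (res a (suc (j ℕ.+ k))) (res a (j ℕ.+ k)) (res a k))
           (∣m∣n⇒∣m+n (∣-trans (p^k∣p^[j+k] j k) (coh a (j ℕ.+ k)))
                      (coh⁺ a j k))
    where
    lem : ∀ x y z → (x ℤ.- y) ℤ.+ (y ℤ.- z) ≡ x ℤ.- z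
    lem = solve-∀

  -- The exact quotient a / pᵏ of an element a whose image in ℤ/pᵏℤ is 0.
  module _ (k : ℕ) (a : ℤₚ) (h : + (p ^ k) ∣ res a k) where

    private
      abstract
        p^k∣ : ∀ j → + (p ^ k) ∣ res a (j ℕ.+ k)
        p^k∣ j = ∣m+n∣n⇒∣m {m = res a (j ℕ.+ k)} {ℤ.- res a k}
                           (coh⁺ a j k) (∣m⇒∣-m h)

      c : ℕ → ℤ
      c j = quotient (p^k∣ j)

      c-eq : ∀ j → res a (j ℕ.+ k) ≡ c j ℤ.* + (p ^ k)
      c-eq j = _∣_.equality (p^k∣ j)

      c-coh : ∀ j → + (p ^ j) ∣ c (suc j) ℤ.- c j
      c-coh j = *-cancelʳ-∣ (+ (p ^ k)) {{ℕ.m^n≢0 p k}}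
        (∣-respˡ lhs (∣-resp rhs (coh a (j ℕ.+ k))))
        where
        lhs : + (p ^ (j ℕ.+ k)) ≡ + (p ^ j) ℤ.* + (p ^ k)
        lhs = trans (cong +_ (ℕ.^-distribˡ-+-* p j k)) (ℤ.pos-* (p ^ j) (p ^ k))
        lem : ∀ x y z → x ℤ.* z ℤ.- y ℤ.* z ≡ (x ℤ.- y) ℤ.* z
        lem = solve-∀
        rhs : res a (suc j ℕ.+ k) ℤ.- res a (j ℕ.+ k)
            ≡ (c (suc j) ℤ.- c j) ℤ.* + (p ^ k)
        rhs = trans (cong₂ ℤ._-_ (c-eq (suc j)) (c-eq j))
                    (lem (c (suc j)) (c j) (+ (p ^ k)))

    exactQuotient : ℤₚ
    exactQuotient = record { res = c ; coh = c-coh }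

    exactQuotient-correct : ι (p ^ k) * exactQuotient ≈ a
    exactQuotient-correct j = ∣-resp eq (coh⁺ a k j)
      where
      eq : res a (k ℕ.+ j) ℤ.- res a j ≡ + (p ^ k) ℤ.* c j ℤ.- res a j
      eq = cong (ℤ._- res a j)
             (trans (cong (res a) (ℕ.+-comm k j))
                    (trans (c-eq j) (ℤ.*-comm (c j) (+ (p ^ k)))))

  ≡[modp^]⇔∣ : ∀ a b k →
               a ≡ b [modp^ k ] ⇔ (∃ λ c → ι (p ^ k) * c ≈ a - b)
  ≡[modp^]⇔∣ a b k = mk⇔
    (λ h → exactQuotient k (a - b) h , exactQuotient-correct k (a - b) h)
    (λ (c , h) → ∣m+n∣m⇒∣n {m = + (p ^ k) ℤ.* res c k ℤ.- res (a - b) k}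
       (∣-resp (lem (+ (p ^ k) ℤ.* res c k) (res (a - b) k)) (∣m⇒∣m*n (res c k) ∣-refl))
       (h k))
    where
    lem : ∀ x y → x ≡ (x ℤ.- y) ℤ.+ y
    lem = solve-∀

  -- The digit a₀ of a = Σ aᵢpⁱ, computed from the image of a in ℤ/pℤ;
  -- %p-decompose and %p-unique characterise it as the leading digit.
  infix 8 _%p

  _%p : ℤₚ → Fin p
  a %p = fromℕ< (n%ℕd<d (res a 1) p)

  private
    p^1∣a-a%p : ∀ a → + (p ^ 1) ∣ res a 1 ℤ.- + toℕ (a %p)
    p^1∣a-a%p a = divides (res a 1 /ℕ p) eq
      where
      lem : ∀ r q → (r ℤ.+ q) ℤ.- r ≡ q
      lem = solve-∀
      eq : res a 1 ℤ.- + toℕ (a %p) ≡ (res a 1 /ℕ p) ℤ.* + (p ^ 1)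
      eq rewrite toℕ-fromℕ< (n%ℕd<d (res a 1) p) | ℕ.^-identityʳ p =
        trans (cong (ℤ._- + (res a 1 %ℕ p)) (a≡a%ℕn+[a/ℕn]*n (res a 1) p))
              (lem (+ (res a 1 %ℕ p)) ((res a 1 /ℕ p) ℤ.* + p))

  -- (a - (a %p)) / p
  shift : ℤₚ → ℤₚ
  shift a = exactQuotient 1 (a - ι (toℕ (a %p))) (p^1∣a-a%p a)

  shift-correct : ∀ a → ι p * shift a ≈ a - ι (toℕ (a %p))
  shift-correct a k =
    subst (λ q → ι q * shift a ≡ a - ι (toℕ (a %p)) [modp^ k ]) (ℕ.^-identityʳ p)
          (exactQuotient-correct 1 (a - ι (toℕ (a %p))) (p^1∣a-a%p a) k)

  %p-decompose : ∀ a → a ≈ ι (toℕ (a %p)) + ι p * shift a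
  %p-decompose a k =
    ∣-resp (lem (+ p ℤ.* res (shift a) k) (res a k) (+ toℕ (a %p)))
           (∣m⇒∣-m (shift-correct a k))
    where
    lem : ∀ s x r → ℤ.- (s ℤ.- (x ℤ.- r)) ≡ x ℤ.- (r ℤ.+ s)
    lem = solve-∀

  %p-unique : ∀ a (r : Fin p) c → a ≈ ι (toℕ r) + ι p * c → a %p ≡ r
  %p-unique a r c h = toℕ-injective (∣-∣≡0 (toℕ<n (a %p)) (toℕ<n r) p∣diff)
    where
    lem : ∀ x r s q → (x ℤ.- (s ℤ.+ q)) ℤ.- (x ℤ.- r) ℤ.+ q ≡ r ℤ.- s
    lem = solve-∀
    p∣diff : + p ∣ + toℕ (a %p) ℤ.- + toℕ r
    p∣diff = ∣-resp (lem (res a 1) (+ toℕ (a %p)) (+ toℕ r) (+ p ℤ.* res c 1))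
      (∣m∣n⇒∣m+n
        (∣m∣n⇒∣m-n (∣-respˡ (cong +_ (ℕ.^-identityʳ p)) (h 1))
                   (∣-respˡ (cong +_ (ℕ.^-identityʳ p)) (p^1∣a-a%p a)))
        (∣m⇒∣m*n (res c 1) ∣-refl))
    ∣-∣≡0 : ∀ {m n} → m < p → n < p → + p ∣ + m ℤ.- + n → m ≡ n
    ∣-∣≡0 {m} {n} m<p n<p d with ∣ + m ℤ.- + n ∣ in eq
    ... | zero  = ℤ.+-injective (ℤ.i-j≡0⇒i≡j (+ m) (+ n) (ℤ.∣i∣≡0⇒i≡0 eq))
    ... | suc q = contradiction (subst (p ℕ.∣_) eq (∣⇒∣ᵤ d)) (ℕ.>⇒∤ q<p)
      where
      q<p : suc q < p
      q<p = subst (_< p)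
        (trans (cong ∣_∣ (sym (ℤ.m-n≡m⊖n m n))) eq)
        (ℕ.≤-<-trans (ℤ.∣m⊝n∣≤m⊔n m n) (ℕ.⊔-pres-<m m<p n<p))

  -- A subset of ℤₚ is a predicate A; functions on it are required to respect _≈_
  -- and not to depend on the proof of membership.
  subset : Pred ℤₚ ℓ → Setoid ℓ 0ℓ
  subset A = On.setoid {B = Σ ℤₚ A} setoid proj₁

  infix 4 _⟶ℤₚ

  _⟶ℤₚ : Pred ℤₚ ℓ → Set ℓ
  A ⟶ℤₚ = Func (subset A) setoid

  Fibred : Pred ℤₚ ℓ → Set ℓ
  Fibred A = Fin p → A ⟶ℤₚ

  module _ {A : Pred ℤₚ ℓ} where

    ⟦_⟧ : Fibred A → Σ ℤₚ A → ℤₚ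
    ⟦ F ⟧ n = shift (Func.to (F (proj₁ n %p)) n)

    Closed : Fibred A → Set ℓ
    Closed F = ∀ n → A (⟦ F ⟧ n)

    step : (F : Fibred A) → Closed F → Σ ℤₚ A → Σ ℤₚ A
    step F closed n = ⟦ F ⟧ n , closed n

    digit : (F : Fibred A) → Closed F → Σ ℤₚ A → ℕ → Fin p
    digit F closed n k = proj₁ (iterate (step F closed) n k) %p

    SameDigits : (F : Fibred A) → Closed F → ℕ → Σ ℤₚ A → Σ ℤₚ A → Set
    SameDigits F closed k m n =
      ∀ i → i < k → digit F closed m i ≡ digit F closed n i

    WeakBlockProperty : (F : Fibred A) → Closed F → Pred ℕ 0ℓ → Set ℓ
    WeakBlockProperty F closed K = ∀ k → K k → ∀ m n →
      proj₁ m ≡ proj₁ n [modp^ k ] → SameDigits F closed k m n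

    BlockProperty : (F : Fibred A) → Closed F → Pred ℕ 0ℓ → Set ℓ
    BlockProperty F closed K = ∀ k → K k → ∀ m n →
      proj₁ m ≡ proj₁ n [modp^ k ] ⇔ SameDigits F closed k m n

    infix 4 _∈_+pℤₚ

    _∈_+pℤₚ : Σ ℤₚ A → Fin p → Set
    m ∈ r +pℤₚ = ∃ λ c → proj₁ m ≈ ι (toℕ r) + ι p * c

    dropDigit : A ⟶ℤₚ → Σ ℤₚ A → ℤₚ
    dropDigit f n = Func.to f n - ι (toℕ (Func.to f n %p))

    WeaklySuitable : Fin p → A ⟶ℤₚ → Pred ℕ 0ℓ → Set ℓ
    WeaklySuitable r f K = ∀ k → K k → ∀ m n → m ∈ r +pℤₚ → n ∈ r +pℤₚ →
      proj₁ m ≡ proj₁ n [modp^ k ] → dropDigit f m ≡ dropDigit f n [modp^ k ]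

    Suitable : Fin p → A ⟶ℤₚ → Pred ℕ 0ℓ → Set ℓ
    Suitable r f K = ∀ k → K k → ∀ m n → m ∈ r +pℤₚ → n ∈ r +pℤₚ →
      proj₁ m ≡ proj₁ n [modp^ k ] ⇔ dropDigit f m ≡ dropDigit f n [modp^ k ]

{-# OPTIONS --safe #-}
module Submission where

open import Defs
open import Data.Nat.Base using (ℕ; _≤_; NonTrivial)
open import Data.Product.Base using (_×_)
open import Function.Bundles using (_⇔_)
open import Level using (Level)
open import Relation.Binary.Definitions using (_Respects_)
open import Relation.Unary using (Pred; U)

open import Data.Fin.Base using (toℕ)
open import Data.Integer.Base as ℤ using (+_)
import Data.Integer.Properties as ℤ
open import Data.Integer.Divisibility.Signed
open import Data.Integer.Tactic.RingSolver using (solve-∀)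
open import Data.Nat.Base using (zero; suc; _^_; z≤n; s≤s; NonZero; nonTrivial⇒nonZero)
import Data.Nat.Properties as ℕ
open import Data.Product.Base using (∃; _,_; proj₁; proj₂)
open import Data.Unit.Base using (tt)
open import Function.Bundles using (Func; mk⇔; module Equivalence)
open import Function.Properties.Equivalence
  using () renaming (sym to ⇔-sym; trans to ⇔-trans)
open import Level using (0ℓ)
open import Relation.Binary.PropositionalEquality
  using (_≡_; refl; sym; trans; cong; subst; subst₂)

open Equivalence using (to; from)

-- Two elements with their leading digits set to 0 agree modulo pᵏ⁺¹ iff their
-- quotients by p agree modulo pᵏ. Hence, for m and n with common leading
-- digit r, the suitability condition on F[r] at k + 1 compares m ≡ n modulo pᵏ⁺¹
-- with F(m) ≡ F(n) modulo pᵏ, while the digit expansions of m and n agree in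
-- k + 1 places iff those of F(m) and F(n) agree in k places. Every claim then
-- follows by recursion on the exponent.

module _ (p : ℕ) .{{_ : NonTrivial p}} where

  open PAdic p

  private
    variable
      ℓ : Level
      K : Pred ℕ 0ℓ

    instance
      p≢0 : NonZero p
      p≢0 = nonTrivial⇒nonZero p

  -- The recursion on the exponent passes from `suc k` to `k`, so `K` must contain predecessors.
  -- This covers both the initial segments and all of ℕ at once.
  DownwardClosed : Pred ℕ 0ℓ → Set
  DownwardClosed K = ∀ k → K (suc k) → K k

  modp^-zero : ∀ a b → a ≡ b [modp^ 0 ]
  modp^-zero a b = divides (res a 0 ℤ.- res b 0) (sym (ℤ.*-identityʳ _))

  pos-^-suc : ∀ k → + (p ^ suc k) ≡ + p ℤ.* + (p ^ k)
  pos-^-suc k = ℤ.pos-* p (p ^ k)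

  -- By coherence, the representative at level `suc k` also represents the class modulo p^k, so
  -- either level may be used to test a congruence modulo p^k.
  res-suc⇔modp^ : ∀ a b k →
    + (p ^ k) ∣ res a (suc k) ℤ.- res b (suc k) ⇔ a ≡ b [modp^ k ]
  res-suc⇔modp^ a b k = mk⇔
    (λ h → ∣m+n∣m⇒∣n (subst (_ ∣_) split h) d)
    (λ h → subst (_ ∣_) (sym split) (∣m∣n⇒∣m+n d h))
    where
    lem : ∀ x y x′ y′ →
          x ℤ.- y ≡ ((x ℤ.- x′) ℤ.- (y ℤ.- y′)) ℤ.+ (x′ ℤ.- y′)
    lem = solve-∀
    split = lem (res a (suc k)) (res b (suc k)) (res a k) (res b k)
    d = ∣m∣n⇒∣m-n (coh a k) (coh b k)

  modp^-pred : ∀ {k} a b → a ≡ b [modp^ suc k ] → a ≡ b [modp^ k ]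
  modp^-pred {k} a b h = to (res-suc⇔modp^ a b k)
    (∣-trans (divides (+ p) (pos-^-suc k)) h)

  modp^-suc⇒modp^1 : ∀ k a b → a ≡ b [modp^ suc k ] → a ≡ b [modp^ 1 ]
  modp^-suc⇒modp^1 zero    a b h = h
  modp^-suc⇒modp^1 (suc k) a b h = modp^-suc⇒modp^1 k a b (modp^-pred a b h)

  -- One factor p cancels in ℤ, but this leaves the representatives of level `suc k`;
  -- `res-suc⇔modp^` brings them down to level `k`.
  p*-modp^ : ∀ a b k → ι p * a ≡ ι p * b [modp^ suc k ] ⇔ a ≡ b [modp^ k ]
  p*-modp^ a b k = ⇔-trans
    (mk⇔
      (λ h → *-cancelˡ-∣ (+ p) (subst₂ _∣_ (pos-^-suc k) factor h))
      (λ h → subst₂ _∣_ (sym (pos-^-suc k)) (sym factor) (*-monoʳ-∣ (+ p) h)))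
    (res-suc⇔modp^ a b k)
    where
    lem : ∀ q x y → q ℤ.* x ℤ.- q ℤ.* y ≡ q ℤ.* (x ℤ.- y)
    lem = solve-∀
    factor = lem (+ p) (res a (suc k)) (res b (suc k))

  -- Both sides of the first congruence are p times the corresponding `shift`, and cancelling p
  -- lowers the exponent by one.
  dropLeading-modp^ : ∀ a b k →
    a - ι (toℕ (a %p)) ≡ b - ι (toℕ (b %p)) [modp^ suc k ]
      ⇔ shift a ≡ shift b [modp^ k ]
  dropLeading-modp^ a b k = ⇔-trans
    (mk⇔
      (λ h → modp^-trans pa a₋ pb a≡ (modp^-trans a₋ b₋ pb h (modp^-sym pb b₋ b≡)))
      (λ h → modp^-trans a₋ pa b₋ (modp^-sym pa a₋ a≡) (modp^-trans pa pb b₋ h b≡)))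
    (p*-modp^ (shift a) (shift b) k)
    where
    pa = ι p * shift a
    pb = ι p * shift b
    a₋ = a - ι (toℕ (a %p))
    b₋ = b - ι (toℕ (b %p))
    a≡ = shift-correct a (suc k)
    b≡ = shift-correct b (suc k)

  -- The congruence yields c with a - b = pc, whence a = r + p(s + c).
  ∈+p-resp-modp^1 : ∀ a b r s → a ≡ b [modp^ 1 ] → b ≈ r + ι p * s →
    ∃ λ c → a ≈ r + ι p * c
  ∈+p-resp-modp^1 a b r s a≡b b≈r+ps = s + c , λ j →
    subst (+ (p ^ j) ∣_)
      (lem (+ p) (res a j) (res b j) (res r j) (res s j) (res c j))
      (∣m∣n⇒∣m-n (b≈r+ps j) (pc≈a-b j))
    where
    p∣a-b = to (≡[modp^]⇔∣ a b 1) a≡b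
    c = proj₁ p∣a-b
    pc≈a-b : ι p * c ≈ a - b
    pc≈a-b = subst (λ q → ι q * c ≈ a - b) (ℕ.^-identityʳ p) (proj₂ p∣a-b)
    lem : ∀ q x y r s c →
          (y ℤ.- (r ℤ.+ q ℤ.* s)) ℤ.- (q ℤ.* c ℤ.- (x ℤ.- y))
            ≡ x ℤ.- (r ℤ.+ q ℤ.* (s ℤ.+ c))
    lem = solve-∀

  %p-cong : ∀ k a b → a ≡ b [modp^ suc k ] → a %p ≡ b %p
  %p-cong k a b h = %p-unique a (b %p) (proj₁ a∈) (proj₂ a∈)
    where
    a∈ = ∈+p-resp-modp^1 a b (ι (toℕ (b %p))) (shift b)
           (modp^-suc⇒modp^1 k a b h) (%p-decompose b)

  module _ {A : Pred ℤₚ ℓ} where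

    ∈+pℤₚ-of-%p : ∀ m {r} → proj₁ m %p ≡ r → _∈_+pℤₚ {A = A} m r
    ∈+pℤₚ-of-%p m refl = shift (proj₁ m) , %p-decompose (proj₁ m)

    ∈+pℤₚ⇒%p : ∀ m {r} → _∈_+pℤₚ {A = A} m r → proj₁ m %p ≡ r
    ∈+pℤₚ⇒%p m {r} (c , h) = %p-unique (proj₁ m) r c h

  module _ {A : Pred ℤₚ ℓ} (F : Fibred A) where

    shift-F≡⟦F⟧ : ∀ {r} m → proj₁ m %p ≡ r → shift (Func.to (F r) m) ≡ ⟦ F ⟧ m
    shift-F≡⟦F⟧ m h = cong (λ s → shift (Func.to (F s) m)) (sym h)

    -- Both arguments select the component `F r`, so `⟦ F ⟧` is the `shift` of its value and
    -- `dropLeading-modp^` applies to the two values. This is the bridge between suitability and one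
    -- step of F.
    dropDigit-modp^ : ∀ {r} m n k → proj₁ m %p ≡ r → proj₁ n %p ≡ r →
      dropDigit (F r) m ≡ dropDigit (F r) n [modp^ suc k ]
        ⇔ ⟦ F ⟧ m ≡ ⟦ F ⟧ n [modp^ k ]
    dropDigit-modp^ {r} m n k m%p≡r n%p≡r =
      subst₂ (λ x y → dropDigit (F r) m ≡ dropDigit (F r) n [modp^ suc k ]
                        ⇔ x ≡ y [modp^ k ])
        (shift-F≡⟦F⟧ m m%p≡r) (shift-F≡⟦F⟧ n n%p≡r)
        (dropLeading-modp^ (Func.to (F r) m) (Func.to (F r) n) k)

    module _ (closed : Closed F) where

      SameDigits-cons : ∀ {k} m n → proj₁ m %p ≡ proj₁ n %p →
        SameDigits F closed k (step F closed m) (step F closed n) →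
        SameDigits F closed (suc k) m n
      SameDigits-cons m n h t zero    _         = h
      SameDigits-cons m n h t (suc i) (s≤s i<k) = t i i<k

      SameDigits-head : ∀ {k} m n →
        SameDigits F closed (suc k) m n → proj₁ m %p ≡ proj₁ n %p
      SameDigits-head m n h = h 0 (s≤s z≤n)

      SameDigits-tail : ∀ {k} m n → SameDigits F closed (suc k) m n →
        SameDigits F closed k (step F closed m) (step F closed n)
      SameDigits-tail m n h i i<k = h (suc i) (s≤s i<k)

      weaklySuitable⇒weakBlock : DownwardClosed K →
        (∀ r → WeaklySuitable r (F r) K) → WeakBlockProperty F closed K
      weaklySuitable⇒weakBlock ↓ ws zero    _ m n _ i ()
      weaklySuitable⇒weakBlock ↓ ws (suc k) Kk m n m≡n =
        SameDigits-cons m n m%p≡n%p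
          (weaklySuitable⇒weakBlock ↓ ws k (↓ k Kk) (step F closed m) (step F closed n)
            (to (dropDigit-modp^ m n k m%p≡n%p refl)
              -- The component is the one at the leading digit of `n`, which `m` shares because the
              -- two agree modulo p.
              (ws _ (suc k) Kk m n
                (∈+pℤₚ-of-%p m m%p≡n%p) (∈+pℤₚ-of-%p n refl) m≡n)))
        where m%p≡n%p = %p-cong k (proj₁ m) (proj₁ n) m≡n

      suitable⇒block : DownwardClosed K →
        (∀ r → Suitable r (F r) K) → BlockProperty F closed K
      suitable⇒block {K = K} ↓ s k Kk m n = mk⇔
        (weaklySuitable⇒weakBlock ↓
          (λ r k Kk m n m∈ n∈ → to (s r k Kk m n m∈ n∈)) k Kk m n)
        (sameDigits⇒≡ k Kk m n)
        where
        -- The first digit puts `m` and `n` in one residue class; the remaining digits give F(m) ≡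
        -- F(n) modulo p^k by recursion, and the converse half of suitability lifts this to m ≡ n
        -- modulo p^(k+1).
        sameDigits⇒≡ : ∀ k → K k → ∀ m n →
          SameDigits F closed k m n → proj₁ m ≡ proj₁ n [modp^ k ]
        sameDigits⇒≡ zero    _  m n _ = modp^-zero (proj₁ m) (proj₁ n)
        sameDigits⇒≡ (suc k) Kk m n h =
          from (s _ (suc k) Kk m n
                 (∈+pℤₚ-of-%p m m%p≡n%p) (∈+pℤₚ-of-%p n refl))
            (from (dropDigit-modp^ m n k m%p≡n%p refl)
              (sameDigits⇒≡ k (↓ k Kk) (step F closed m) (step F closed n)
                (SameDigits-tail m n h)))
          where m%p≡n%p = SameDigits-head m n h

      block⇒suitable : DownwardClosed K →
        BlockProperty F closed K → ∀ r → Suitable r (F r) K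
      block⇒suitable ↓ b r zero    _  m n _  _  = mk⇔
        (λ _ → modp^-zero (dropDigit (F r) m) (dropDigit (F r) n))
        (λ _ → modp^-zero (proj₁ m) (proj₁ n))
      block⇒suitable ↓ b r (suc k) Kk m n m∈ n∈ =
        -- No recursion here: the block property at `suc k` turns m ≡ n into equal digits, the
        -- common head r is split off, and the block property at `k` turns the tails into F(m) ≡
        -- F(n).
        ⇔-trans (b (suc k) Kk m n)
          (⇔-trans
            (mk⇔ (SameDigits-tail m n)
                 (SameDigits-cons m n (trans m%p≡r (sym n%p≡r))))
            (⇔-trans
              (⇔-sym (b k (↓ k Kk) (step F closed m) (step F closed n)))
              (⇔-sym (dropDigit-modp^ m n k m%p≡r n%p≡r))))
        where
        m%p≡r = ∈+pℤₚ⇒%p m m∈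
        n%p≡r = ∈+pℤₚ⇒%p n n∈

      suitable⇔block : DownwardClosed K →
        (∀ r → Suitable r (F r) K) ⇔ BlockProperty F closed K
      suitable⇔block ↓ = mk⇔ (suitable⇒block ↓) (block⇒suitable ↓)

theorem4p1 : {ℓ : Level} (p : ℕ) .{{_ : NonTrivial p}} →
    let open PAdic p in
    (A : Pred ℤₚ ℓ) → A Respects _≈_ →
    (F : Fibred A) (closed : Closed F) (k : ℕ) → 1 ≤ k →
    ((∀ r → WeaklySuitable r (F r) (upTo k)) →
    WeakBlockProperty F closed (upTo k))
    × ((∀ r → WeaklySuitable r (F r) U) → WeakBlockProperty F closed U)
    × ((∀ r → Suitable r (F r) (upTo k)) ⇔ BlockProperty F closed (upTo k))
    × ((∀ r → Suitable r (F r) U) ⇔ BlockProperty F closed U)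
theorem4p1 p A _ F closed k _ =
    weaklySuitable⇒weakBlock p F closed upTo-↓
  , weaklySuitable⇒weakBlock p F closed U-↓
  , suitable⇔block p F closed upTo-↓
  , suitable⇔block p F closed U-↓
  where
  upTo-↓ : DownwardClosed p (upTo k)
  upTo-↓ _ = ℕ.<⇒≤
  U-↓ : DownwardClosed p U
  U-↓ _ _ = tt
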